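{- Consider {\L}ukasiewicz real-valued logic, in which the disjunction $\lor$ has $f_\lor(a,b)=\min\{1,a+b\}$, and let $A_1,A_2$ be distinct atomic propositions. There is no finite Boolean combination (built with classical $\land,\lor,\neg$ over sentences) of sentences of the form $(A_1,S)$ or $(A_2,S)$, with $S\subseteq[0,1]$ arbitrary, that is equivalent to the sentence $(A_1\lor A_2,\{0.5\})$ (i.e., has exactly the same models).
   Context: Setting (real-valued logic). Fix a finite set of atomic propositions, a finite set of binary connectives and a finite set of unary connectives. Each binary connective $\alpha$ comes with a function $f_\alpha:[0,1]^2\to[0,1]$ and each unary connective $\rho$ with a function $f_\rho:[0,1]\to[0,1]$. Formulas are built recursively from atomic propositions using the connectives. A model $M$ assigns a value in $[0,1]$ to each atomic proposition; the value of a compound formula is computed recursively via $f_\alpha$, $f_\rho$. A sentence is $(\sigma_1,\ldots,\sigma_k,S)$ with pairwise distinct formulas $\sigma_i$ and $S\subseteq[0,1]^k$; $M$ satisfies it if the tuple of values of $\sigma_1,\ldots,\sigma_k$ in $M$ lies in $S$. A Boolean combination of sentences is satisfied by $M$ according to the classical truth-table reading of $\land,\lor,\neg$ applied to the satisfaction of its constituent sentences. -}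

module Defs where

open import Algebra.Core using (Op₁; Op₂)
open import Algebra.Definitions using (Congruent₁; Congruent₂)
open import Data.Fin using (Fin)
open import Data.Fin.Patterns using (0F)
open import Data.Nat as ℕ using (ℕ)
import Data.Nat.Properties as ℕ
open import Data.Product using (∃-syntax; _×_; _,_)
open import Data.Rational as ℚ
  using (ℚ; 0ℚ; 1ℚ; ½; ∣_∣; _+_; _-_; -_; _*_; _<_; _≤_; _⊓_)
import Data.Rational.Properties as ℚ
open import Data.Rational.Solver using (module +-*-Solver)
open import Data.Sum using (inj₁; inj₂)
open import Data.Vec.Functional using (Vector; []; _∷_)
open import Data.Vec.Functional.Relation.Binary.Pointwise using (Pointwise)
open import Function using (Injective; _⇔_)
open import Level using (Level; 0ℓ) renaming (suc to lsuc)
open import Relation.Binary.Core using (Rel)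
open import Relation.Binary.Definitions using (Symmetric; Transitive; _Respects_)
open import Relation.Binary.PropositionalEquality
  using (_≡_; refl; sym; cong; subst; subst₂)
open import Relation.Nullary using (¬_)
open import Relation.Nullary.Decidable using (from-yes)
open import Relation.Unary using (Pred)

------------------------------------------------------------------------
-- Rational estimates

private
  <-cast : ∀ {p q r s} → p ≡ r → q ≡ s → p < q → r < s
  <-cast = subst₂ _<_

  p≤∣p∣ : ∀ p → p ≤ ∣ p ∣
  p≤∣p∣ p with ℚ.≤-total 0ℚ p
  ... | inj₁ 0≤p = ℚ.≤-reflexive (sym (ℚ.0≤p⇒∣p∣≡p 0≤p))
  ... | inj₂ p≤0 = ℚ.≤-trans p≤0 (ℚ.0≤∣p∣ p)

  ∣-∣-comm : ∀ p q → ∣ p - q ∣ ≡ ∣ q - p ∣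
  ∣-∣-comm p q rewrite sym (ℚ.∣-p∣≡∣p∣ (p - q)) =
    cong ∣_∣ (solve 2 (λ p q → :- (p :- q) := q :- p) refl p q)
    where open +-*-Solver

  close⇒< : ∀ p q {ε} → ∣ p - q ∣ < ε → p < q + ε
  close⇒< p q {ε} h =
    <-cast (solve 2 (λ p q → q :+ (p :- q) := p) refl p q) refl
      (ℚ.+-monoʳ-< q (ℚ.≤-<-trans (p≤∣p∣ (p - q)) h))
    where open +-*-Solver

  close⇒> : ∀ p q {ε} → ∣ p - q ∣ < ε → q < p + ε
  close⇒> p q {ε} h = close⇒< q p (subst (_< ε) (∣-∣-comm p q) h)

  <⇒diff : ∀ p q {ε} → p < q + ε → p - q < ε
  <⇒diff p q {ε} h =
    <-cast refl (solve 2 (λ q e → (q :+ e) :- q := e) refl q ε) (ℚ.+-monoˡ-< (- q) h)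
    where open +-*-Solver

  <⇒close : ∀ p q {ε} → p < q + ε → q < p + ε → ∣ p - q ∣ < ε
  <⇒close p q {ε} h k with ℚ.∣p∣≡p∨∣p∣≡-p (p - q)
  ... | inj₁ eq = subst (_< ε) (sym eq) (<⇒diff p q h)
  ... | inj₂ eq = subst (_< ε) (sym eq)
    (subst (_< ε) (solve 2 (λ p q → q :- p := :- (p :- q)) refl p q) (<⇒diff q p k))
    where open +-*-Solver

  0<½*ε : ∀ {ε} → 0ℚ < ε → 0ℚ < ½ * ε
  0<½*ε = ℚ.*-monoʳ-<-pos ½

  p<p+ε : ∀ p {ε} → 0ℚ < ε → p < p + ε
  p<p+ε p 0<ε = <-cast (ℚ.+-identityʳ p) refl (ℚ.+-monoʳ-< p 0<ε)

  +-shift : ∀ p q r s {ε} → p < r + ½ * ε → q < s + ½ * ε → p + q < (r + s) + ε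
  +-shift p q r s {ε} h k =
    <-cast refl
      (solve 3 (λ r s e → (r :+ con ½ :* e) :+ (s :+ con ½ :* e) := (r :+ s) :+ e) refl r s ε)
      (ℚ.+-mono-< h k)
    where open +-*-Solver

  trans-shift : ∀ p q r {ε} → p < q + ½ * ε → q < r + ½ * ε → p < r + ε
  trans-shift p q r {ε} h k = ℚ.<-trans h
    (<-cast refl
      (solve 2 (λ r e → (r :+ con ½ :* e) :+ con ½ :* e := r :+ e) refl r ε)
      (ℚ.+-monoˡ-< (½ * ε) k))
    where open +-*-Solver

  ⊓-shift : ∀ p q r s {ε} → p < r + ε → q < s + ε → p ⊓ q < (r ⊓ s) + ε
  ⊓-shift p q r s {ε} h k with ℚ.⊓-sel r s
  ... | inj₁ eq rewrite eq = ℚ.≤-<-trans (ℚ.p⊓q≤p p q) h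
  ... | inj₂ eq rewrite eq = ℚ.≤-<-trans (ℚ.p⊓q≤q p q) k

  close-refl : ∀ p {ε} → 0ℚ < ε → ∣ p - p ∣ < ε
  close-refl p 0<ε = <⇒close p p (p<p+ε p 0<ε) (p<p+ε p 0<ε)

  close-trans : ∀ p q r {ε} → ∣ p - q ∣ < ½ * ε → ∣ q - r ∣ < ½ * ε → ∣ p - r ∣ < ε
  close-trans p q r h k = <⇒close p r
    (trans-shift p q r (close⇒< p q h) (close⇒< q r k))
    (trans-shift r q p (close⇒> q r k) (close⇒> p q h))

  +-close : ∀ p q r s {ε} → ∣ p - r ∣ < ½ * ε → ∣ q - s ∣ < ½ * ε →
            ∣ (p + q) - (r + s) ∣ < ε
  +-close p q r s h k = <⇒close (p + q) (r + s)
    (+-shift p q r s (close⇒< p r h) (close⇒< q s k))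
    (+-shift r s p q (close⇒> p r h) (close⇒> q s k))

  ⊓-close : ∀ p q r s {ε} → ∣ p - r ∣ < ε → ∣ q - s ∣ < ε →
            ∣ (p ⊓ q) - (r ⊓ s) ∣ < ε
  ⊓-close p q r s h k = <⇒close (p ⊓ q) (r ⊓ s)
    (⊓-shift p q r s (close⇒< p r h) (close⇒< q s k))
    (⊓-shift r s p q (close⇒> p r h) (close⇒> q s k))

------------------------------------------------------------------------
-- The real numbers, as Cauchy sequences of rationals up to ≃ℝ

Eventually : Pred ℕ 0ℓ → Set
Eventually P = ∃[ N ] (∀ n → N ℕ.≤ n → P n)

private
  both : ∀ {P Q R : Pred ℕ 0ℓ} → (∀ n → P n → Q n → R n) →
         Eventually P → Eventually Q → Eventually R
  both f (M , p) (N , q) = M ℕ.⊔ N , λ n h →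
    f n (p n (ℕ.m⊔n≤o⇒m≤o M N h)) (q n (ℕ.m⊔n≤o⇒n≤o M N h))

IsCauchy : Pred (ℕ → ℚ) 0ℓ
IsCauchy x = ∀ ε → 0ℚ < ε →
  ∃[ N ] (∀ m n → N ℕ.≤ m → N ℕ.≤ n → ∣ x m - x n ∣ < ε)

record ℝ : Set where
  constructor mkℝ
  field
    seq    : ℕ → ℚ
    cauchy : IsCauchy seq

open ℝ public

infix 4 _≃ℝ_ _≤ℝ_

_≃ℝ_ : Rel ℝ 0ℓ
x ≃ℝ y = ∀ ε → 0ℚ < ε → Eventually λ n → ∣ seq x n - seq y n ∣ < ε

_≤ℝ_ : Rel ℝ 0ℓ
x ≤ℝ y = ∀ ε → 0ℚ < ε → Eventually λ n → seq x n < seq y n + ε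

≃ℝ-sym : Symmetric _≃ℝ_
≃ℝ-sym {x} {y} x≃y ε 0<ε with N , h ← x≃y ε 0<ε =
  N , λ n N≤n → subst (_< ε) (∣-∣-comm (seq x n) (seq y n)) (h n N≤n)

≃ℝ-trans : Transitive _≃ℝ_
≃ℝ-trans {x} {y} {z} x≃y y≃z ε 0<ε =
  both (λ n → close-trans (seq x n) (seq y n) (seq z n))
       (x≃y (½ * ε) (0<½*ε 0<ε)) (y≃z (½ * ε) (0<½*ε 0<ε))

fromℚ : ℚ → ℝ
fromℚ q = mkℝ (λ _ → q) λ ε 0<ε → 0 , λ _ _ _ _ → close-refl q 0<ε

infixl 6 _+ℝ_
infixl 7 _⊓ℝ_

_+ℝ_ : Op₂ ℝ
mkℝ x cx +ℝ mkℝ y cy = mkℝ (λ n → x n + y n) λ ε 0<ε →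
  let M , h = cx (½ * ε) (0<½*ε 0<ε)
      N , k = cy (½ * ε) (0<½*ε 0<ε)
  in M ℕ.⊔ N , λ m n ≤m ≤n → +-close (x m) (y m) (x n) (y n)
       (h m n (ℕ.m⊔n≤o⇒m≤o M N ≤m) (ℕ.m⊔n≤o⇒m≤o M N ≤n))
       (k m n (ℕ.m⊔n≤o⇒n≤o M N ≤m) (ℕ.m⊔n≤o⇒n≤o M N ≤n))

_⊓ℝ_ : Op₂ ℝ
mkℝ x cx ⊓ℝ mkℝ y cy = mkℝ (λ n → x n ⊓ y n) λ ε 0<ε →
  let M , h = cx ε 0<ε
      N , k = cy ε 0<ε
  in M ℕ.⊔ N , λ m n ≤m ≤n → ⊓-close (x m) (y m) (x n) (y n)
       (h m n (ℕ.m⊔n≤o⇒m≤o M N ≤m) (ℕ.m⊔n≤o⇒m≤o M N ≤n))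
       (k m n (ℕ.m⊔n≤o⇒n≤o M N ≤m) (ℕ.m⊔n≤o⇒n≤o M N ≤n))

0ℝ 1ℝ : ℝ
0ℝ = fromℚ 0ℚ
1ℝ = fromℚ 1ℚ

------------------------------------------------------------------------
-- The unit interval [0,1]

record 𝕀 : Set where
  constructor mk𝕀
  field
    value : ℝ
    lower : 0ℝ ≤ℝ value
    upper : value ≤ℝ 1ℝ

open 𝕀 public

infix 4 _≈_

_≈_ : Rel 𝕀 0ℓ
a ≈ b = value a ≃ℝ value b

½𝕀 : 𝕀
½𝕀 = mk𝕀 (fromℚ ½)
  (λ ε 0<ε → 0 , λ _ _ → ℚ.<-trans (from-yes (0ℚ ℚ.<? ½)) (p<p+ε ½ 0<ε))
  (λ ε 0<ε → 0 , λ _ _ → ℚ.<-trans (from-yes (½ ℚ.<? 1ℚ)) (p<p+ε 1ℚ 0<ε))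

infixl 6 _⊕_

_⊕_ : Op₂ 𝕀
a ⊕ b = mk𝕀 (1ℝ ⊓ℝ (value a +ℝ value b))
  (λ ε 0<ε → both
     (λ n h k → ⊓-shift 0ℚ 0ℚ 1ℚ (a+b n)
        (ℚ.<-trans (from-yes (0ℚ ℚ.<? 1ℚ)) (p<p+ε 1ℚ 0<ε))
        (+-shift 0ℚ 0ℚ (seq (value a) n) (seq (value b) n) h k))
     (lower a (½ * ε) (0<½*ε 0<ε)) (lower b (½ * ε) (0<½*ε 0<ε)))
  (λ ε 0<ε → 0 , λ n _ → ℚ.≤-<-trans (ℚ.p⊓q≤p 1ℚ (a+b n)) (p<p+ε 1ℚ 0<ε))
  where
  a+b : ℕ → ℚ
  a+b = seq (value a +ℝ value b)

-- Subsets of [0,1]ᵏ: arbitrary predicates that do not distinguish different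
-- representations of the same real numbers.
record Subset (k : ℕ) (ℓ : Level) : Set (lsuc ℓ) where
  field
    _∋_      : Pred (Vector 𝕀 k) ℓ
    respects : _∋_ Respects Pointwise _≈_

singleton : 𝕀 → Subset 1 0ℓ
singleton a = record
  { _∋_      = λ v → v 0F ≈ a
  ; respects = λ {v} {w} v≈w v≈a →
      ≃ℝ-trans {value (w 0F)} {value (v 0F)} {value a}
        (≃ℝ-sym {value (v 0F)} {value (w 0F)} (v≈w 0F)) v≈a
  }

------------------------------------------------------------------------
-- Real-valued logics

record Logic : Set where
  field
    #atoms #binary #unary : ℕ
    f₂      : Fin #binary → Op₂ 𝕀
    f₂-cong : ∀ α → Congruent₂ _≈_ (f₂ α)
    f₁      : Fin #unary → Op₁ 𝕀
    f₁-cong : ∀ ρ → Congruent₁ _≈_ (f₁ ρ)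

module _ (L : Logic) where
  open Logic L

  data Formula : Set where
    atomic : Fin #atoms → Formula
    binary : Fin #binary → Formula → Formula → Formula
    unary  : Fin #unary → Formula → Formula

  Model : Set
  Model = Fin #atoms → 𝕀

  record Sentence (ℓ : Level) : Set (lsuc ℓ) where
    field
      arity    : ℕ
      formulas : Vector Formula arity
      distinct : Injective _≡_ _≡_ formulas
      set      : Subset arity ℓ

module _ {L : Logic} where
  open Logic L

  ⟦_⟧ : Formula L → Model L → 𝕀
  ⟦ atomic A     ⟧ M = M A
  ⟦ binary α σ τ ⟧ M = f₂ α (⟦ σ ⟧ M) (⟦ τ ⟧ M)
  ⟦ unary ρ σ    ⟧ M = f₁ ρ (⟦ σ ⟧ M)

  infix 4 _⊨_ _⊨ᵇ_

  _⊨_ : ∀ {ℓ} → Model L → Sentence L ℓ → Set ℓ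
  M ⊨ s = Subset._∋_ (Sentence.set s) λ i → ⟦ Sentence.formulas s i ⟧ M

  ⟨_,_⟩ : ∀ {ℓ} → Formula L → Subset 1 ℓ → Sentence L ℓ
  ⟨ σ , S ⟩ = record
    { arity    = 1
    ; formulas = σ ∷ []
    ; distinct = λ { {0F} {0F} _ → refl }
    ; set      = S
    }

  -- Finite Boolean combinations of the sentences in the class 𝒞.
  data BooleanCombination {c ℓ} (𝒞 : Pred (Sentence L ℓ) c) : Set (c Level.⊔ lsuc ℓ) where
    sentence : ∀ s → 𝒞 s → BooleanCombination 𝒞
    and or   : BooleanCombination 𝒞 → BooleanCombination 𝒞 → BooleanCombination 𝒞
    not      : BooleanCombination 𝒞 → BooleanCombination 𝒞

  -- Subsets need not be decidable, so satisfaction is a proposition rather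
  -- than a Boolean, and the truth-table disjunction is ¬ (¬ P × ¬ Q).  The
  -- stronger P ⊎ Q would satisfy fewer classical equivalences.
  _⊨ᵇ_ : ∀ {c ℓ} {𝒞 : Pred (Sentence L ℓ) c} → Model L → BooleanCombination 𝒞 → Set ℓ
  M ⊨ᵇ sentence s _ = M ⊨ s
  M ⊨ᵇ and φ ψ      = (M ⊨ᵇ φ) × (M ⊨ᵇ ψ)
  M ⊨ᵇ or φ ψ       = ¬ (¬ (M ⊨ᵇ φ) × ¬ (M ⊨ᵇ ψ))
  M ⊨ᵇ not φ        = ¬ (M ⊨ᵇ φ)

  Equivalent : ∀ {c ℓ ℓ′} {𝒞 : Pred (Sentence L ℓ) c} →
               BooleanCombination 𝒞 → Sentence L ℓ′ → Set (ℓ Level.⊔ ℓ′)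
  Equivalent φ s = ∀ M → (M ⊨ᵇ φ) ⇔ (M ⊨ s)

  -- The sentences of the form (σ , S) or (τ , S).
  data About {ℓ} (σ τ : Formula L) : Pred (Sentence L ℓ) (lsuc ℓ) where
    first  : ∀ S → About σ τ ⟨ σ , S ⟩
    second : ∀ S → About σ τ ⟨ τ , S ⟩

-- Of the connectives of Łukasiewicz logic only the disjunction is pinned down:
-- whatever others are present play no role here.
record ŁukasiewiczLogic : Set where
  field
    logic : Logic
  open Logic logic public
  field
    ∨   : Fin #binary
    f-∨ : ∀ a b → f₂ ∨ a b ≈ a ⊕ b

{-# OPTIONS --safe #-}
-- On the line x + y = ½ every point (xᵢ , ½ - xᵢ) satisfies A₁ ∨ A₂ = ½.  The
-- finitely many sets occurring in φ separate only finitely many values of A₁,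
-- so among enough points two have first coordinates xᵢ ≠ xⱼ that φ cannot tell
-- apart.  Then φ holds at (xⱼ , ½ - xᵢ), which is off the line.  As the sets
-- need not be decidable, the classification of the values exists only up to ¬¬.
module Submission where

open import Algebra.Properties.Group using (x∙y⁻¹≈ε⇒x≈y)
open import Defs
open import Data.Fin using (Fin; combine; toℕ)
open import Data.Fin.Patterns using (0F; 1F)
open import Data.Fin.Properties using (pigeonhole; combine-injective; sequence)
open import Data.Nat as ℕ using (ℕ; zero; suc)
import Data.Nat.Properties as ℕ
open import Data.Product using (Σ-syntax; _,_)
open import Data.Product.Function.NonDependent.Propositional using (_×-⇔_)
open import Data.Rational using (ℚ; 0ℚ; 1ℚ; ½; _+_; _-_; -_; _*_; _<_; _≤_; _⊓_; ∣_∣)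
import Data.Rational.Properties as ℚ
open import Data.Rational.Solver using (module +-*-Solver)
open import Data.Sum using (inj₁; inj₂)
open import Data.Vec.Functional using (Vector; updateAt)
open import Data.Vec.Functional.Properties using (updateAt-updates; updateAt-minimal)
open import Effect.Monad using (RawMonad)
open import Function using (_⇔_; mk⇔; module Equivalence)
open import Function.Construct.Composition using (_⇔-∘_)
open import Function.Related.TypeIsomorphisms using (¬-cong-⇔)
open import Level using (Level)
open import Relation.Binary.Core using (Rel)
open import Relation.Binary.Definitions using (tri<; tri≈; tri>)
open import Relation.Binary.PropositionalEquality
  using (_≡_; _≢_; refl; sym; trans; cong; subst; subst₂)
open import Relation.Nullary using (¬_; Dec; yes; no; contradiction; ¬¬-excluded-middle)
open import Relation.Nullary.Decidable using (from-yes)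
open import Relation.Nullary.Negation using (¬¬-Monad)
open import Relation.Unary using (Pred)

private
  variable
    ℓ ℓ′ : Level
    n k l : ℕ

  -- For an equivalence `R` this bounds the number of its classes by `k`. Related indices may still
  -- differ in colour, so colourings can be refined freely.
  Coloured : ∀ n → ℕ → Rel (Fin n) ℓ → Set ℓ
  Coloured n k R = Σ[ c ∈ (Fin n → Fin k) ] (∀ i j → c i ≡ c j → R i j)

  -- Double negation commutes with conjunctions over a finite index set, so excluded middle at each
  -- index suffices.
  ¬¬-decide : (P : Pred (Fin n) ℓ) → ¬ ¬ (∀ i → Dec (P i))
  ¬¬-decide P = sequence (RawMonad.rawApplicative ¬¬-Monad) (λ _ → ¬¬-excluded-middle)

  colour-pred : (P : Pred (Fin n) ℓ) → ¬ ¬ Coloured n 2 (λ i j → P i ⇔ P j)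
  colour-pred P ¬c = ¬¬-decide P λ P? →
    ¬c ((λ i → colour (P? i)) , λ i j → same (P? i) (P? j))
    where
    colour : ∀ {A : Set ℓ} → Dec A → Fin 2
    colour (yes _) = 0F
    colour (no  _) = 1F

    same : ∀ {A B : Set ℓ} (a? : Dec A) (b? : Dec B) → colour a? ≡ colour b? → A ⇔ B
    same (yes a) (yes b) _ = mk⇔ (λ _ → b) (λ _ → a)
    same (no ¬a) (no ¬b) _ = mk⇔ (λ a → contradiction a ¬a) (λ b → contradiction b ¬b)

  colour-map : {R : Rel (Fin n) ℓ} {S : Rel (Fin n) ℓ′} → (∀ {i j} → R i j → S i j) →
               ¬ ¬ Coloured n k R → ¬ ¬ Coloured n k S
  colour-map f ¬¬c ¬d = ¬¬c λ (c , R) → ¬d (c , λ i j eq → f (R i j eq))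

  -- Each index gets its pair of colours, encoded by `combine`; equal pairs agree in both
  -- components.
  colour-zip : {R S T : Rel (Fin n) ℓ} → (∀ {i j} → R i j → S i j → T i j) →
               ¬ ¬ Coloured n k R → ¬ ¬ Coloured n l S → ¬ ¬ Coloured n (k ℕ.* l) T
  colour-zip f ¬¬c ¬¬d ¬e = ¬¬c λ (c , R) → ¬¬d λ (d , S) →
    ¬e ( (λ i → combine (c i) (d i))
       , λ i j eq → let cᵢ≡cⱼ , dᵢ≡dⱼ = combine-injective (c i) (d i) (c j) (d j) eq
                    in f (R i j cᵢ≡cⱼ) (S i j dᵢ≡dⱼ))

  ≈-reflexive : ∀ {a b} → a ≡ b → a ≈ b
  ≈-reflexive {a} refl ε 0<ε with N , h ← cauchy (value a) ε 0<ε =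
    N , λ n N≤n → h n n N≤n N≤n

  -- Vectors are functions, so agreement at `0F` does not make them propositionally equal;
  -- membership is transported by `respects` instead.
  ∋-cong : (S : Subset 1 ℓ) {v w : Vector 𝕀 1} → v 0F ≡ w 0F → (S Subset.∋ v) ⇔ (S Subset.∋ w)
  ∋-cong S v≡w = mk⇔ (respects λ { 0F → ≈-reflexive v≡w })
                     (respects λ { 0F → ≈-reflexive (sym v≡w) })
    where open Subset S

module _ {L : Logic} {σ τ : Formula L} (M : 𝕀 → 𝕀 → Model L)
         (⟦σ⟧ : ∀ a b → ⟦ σ ⟧ (M a b) ≡ a) (⟦τ⟧ : ∀ a b → ⟦ τ ⟧ (M a b) ≡ b) where

  Combination : ∀ ℓ → Set _
  Combination ℓ = BooleanCombination {ℓ = ℓ} (About σ τ)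

  -- A set for `σ` splits the values of `σ` in two; a set for `τ` splits nothing, because the
  -- compared models share `b`. The bound depends on `φ` and not on how many values are coloured.
  colours : Combination ℓ → ℕ
  colours (sentence _ (first  S)) = 2
  colours (sentence _ (second S)) = 1
  colours (and φ ψ)               = colours φ ℕ.* colours ψ
  colours (or  φ ψ)               = colours φ ℕ.* colours ψ
  colours (not φ)                 = colours φ

  -- The quantifier over `b` is inside because the second coordinate is chosen only after the
  -- pigeonhole principle has produced the two indices.
  Indiscernible : Combination ℓ → Rel 𝕀 ℓ
  Indiscernible φ a a′ = ∀ b → (M a b ⊨ᵇ φ) ⇔ (M a′ b ⊨ᵇ φ)

  colouring : (x : Fin n → 𝕀) (φ : Combination ℓ) →
              ¬ ¬ Coloured n (colours φ) (λ i j → Indiscernible φ (x i) (x j))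
  colouring x (sentence _ (first S)) =
    colour-map (λ Sᵢ⇔Sⱼ b → ∋-cong S (sym (⟦σ⟧ _ b)) ⇔-∘ (Sᵢ⇔Sⱼ ⇔-∘ ∋-cong S (⟦σ⟧ _ b)))
               (colour-pred λ i → S Subset.∋ λ _ → x i)
  colouring x (sentence _ (second S)) ¬c =
    ¬c ((λ _ → 0F) , λ i j _ b → ∋-cong S (trans (⟦τ⟧ (x i) b) (sym (⟦τ⟧ (x j) b))))
  colouring x (and φ ψ) =
    colour-zip (λ p q b → p b ×-⇔ q b) (colouring x φ) (colouring x ψ)
  colouring x (or φ ψ) =
    colour-zip (λ p q b → ¬-cong-⇔ (¬-cong-⇔ (p b) ×-⇔ ¬-cong-⇔ (q b)))
               (colouring x φ) (colouring x ψ)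
  colouring x (not φ) = colour-map (λ p b → ¬-cong-⇔ (p b)) (colouring x φ)

private
  -- A positive distance could itself be taken as `ε`, making it smaller than itself.
  fromℚ-injective : ∀ {p q} → fromℚ p ≃ℝ fromℚ q → p ≡ q
  fromℚ-injective {p} {q} p≃q with ℚ.<-cmp 0ℚ ∣ p - q ∣
  ... | tri< 0<d _ _ = let N , h = p≃q _ 0<d in contradiction (h N ℕ.≤-refl) (ℚ.<-irrefl refl)
  ... | tri≈ _ 0≡d _ = x∙y⁻¹≈ε⇒x≈y ℚ.+-0-group p q (ℚ.∣p∣≡0⇒p≡0 (p - q) (sym 0≡d))
  ... | tri> _ _ d<0 = contradiction (ℚ.≤-<-trans (ℚ.0≤∣p∣ (p - q)) d<0) (ℚ.<-irrefl refl)

  -- Truncation at 1 is inactive here, since it would give the value 1.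
  1⊓p≡½⇒p≡½ : ∀ {p} → 1ℚ ⊓ p ≡ ½ → p ≡ ½
  1⊓p≡½⇒p≡½ {p} 1⊓p≡½ with ℚ.⊓-sel 1ℚ p
  ... | inj₁ 1⊓p≡1 = contradiction (trans (sym 1⊓p≡1) 1⊓p≡½) λ ()
  ... | inj₂ 1⊓p≡p = trans (sym 1⊓p≡p) 1⊓p≡½

  p+[½-q]≡½⇒p≡q : ∀ p q → p + (½ - q) ≡ ½ → p ≡ q
  p+[½-q]≡½⇒p≡q p q eq = x∙y⁻¹≈ε⇒x≈y ℚ.+-0-group p q (trans
    (solve 2 (λ p q → p :- q := (p :+ (con ½ :- q)) :- con ½) refl p q)
    (cong (_- ½) eq))
    where open +-*-Solver

  p≤q⇒0≤q-p : ∀ {p q} → p ≤ q → 0ℚ ≤ q - p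
  p≤q⇒0≤q-p {p} {q} p≤q =
    subst (_≤ q - p) (ℚ.+-inverseʳ p) (ℚ.+-monoˡ-≤ (- p) p≤q)

  0≤p⇒q-p≤q : ∀ {p q} → 0ℚ ≤ p → q - p ≤ q
  0≤p⇒q-p≤q {p} {q} 0≤p =
    subst (q - p ≤_) (ℚ.+-identityʳ q) (ℚ.+-monoʳ-≤ q (ℚ.neg-antimono-≤ 0≤p))

  ≤⇒fromℚ-≤ℝ : ∀ {p q} → p ≤ q → fromℚ p ≤ℝ fromℚ q
  ≤⇒fromℚ-≤ℝ {p} {q} p≤q ε 0<ε = 0 , λ _ _ →
    subst (_< q + ε) (ℚ.+-identityʳ p) (ℚ.+-mono-≤-< p≤q 0<ε)

  fromℚ-𝕀 : ∀ q → 0ℚ ≤ q → q ≤ 1ℚ → 𝕀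
  fromℚ-𝕀 q 0≤q q≤1 = mk𝕀 (fromℚ q) (≤⇒fromℚ-≤ℝ 0≤q) (≤⇒fromℚ-≤ℝ q≤1)

  -- A supply of infinitely many distinct first coordinates. Starting at `½` keeps `½ - ½^1+ n`
  -- nonnegative.
  ½^1+ : ℕ → ℚ
  ½^1+ zero    = ½
  ½^1+ (suc n) = ½ * ½^1+ n

  0<½^1+ : ∀ n → 0ℚ < ½^1+ n
  0<½^1+ zero    = from-yes (0ℚ ℚ.<? ½)
  0<½^1+ (suc n) = ℚ.*-monoʳ-<-pos ½ (0<½^1+ n)

  ½≤1 : ½ ≤ 1ℚ
  ½≤1 = from-yes (½ ℚ.≤? 1ℚ)

  ½^1+<1 : ∀ n → ½^1+ n < 1ℚ
  ½^1+<1 zero    = from-yes (½ ℚ.<? 1ℚ)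
  ½^1+<1 (suc n) = ℚ.<-≤-trans (ℚ.*-monoʳ-<-pos ½ (½^1+<1 n)) ½≤1

  ½^1+-antitone : ∀ {m n} → m ℕ.< n → ½^1+ n < ½^1+ m
  -- The upper bound arises as `½ * 1ℚ`, which computes to `½`.
  ½^1+-antitone {zero}  {suc n} _           = ℚ.*-monoʳ-<-pos ½ (½^1+<1 n)
  ½^1+-antitone {suc m} {suc n} (ℕ.s<s m<n) = ℚ.*-monoʳ-<-pos ½ (½^1+-antitone m<n)

  ½^1+≤½ : ∀ n → ½^1+ n ≤ ½
  ½^1+≤½ zero    = ℚ.≤-refl
  ½^1+≤½ (suc n) = ℚ.<⇒≤ (½^1+-antitone {0} {suc n} ℕ.z<s)

  x y : ℕ → 𝕀
  x n = fromℚ-𝕀 (½^1+ n) (ℚ.<⇒≤ (0<½^1+ n)) (ℚ.<⇒≤ (½^1+<1 n))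
  y n = fromℚ-𝕀 (½ - ½^1+ n) (p≤q⇒0≤q-p (½^1+≤½ n))
                 (ℚ.≤-trans (0≤p⇒q-p≤q (ℚ.<⇒≤ (0<½^1+ n))) ½≤1)

  x⊕y≈½ : ∀ n → x n ⊕ y n ≈ ½𝕀
  -- Both sequences are constant, and after rewriting by `sum` their distance computes to `0ℚ`.
  x⊕y≈½ n ε 0<ε = 0 , λ _ _ → subst (_< ε) (sym (cong (λ p → ∣ (1ℚ ⊓ p) - ½ ∣) sum)) 0<ε
    where
    open +-*-Solver
    sum : ½^1+ n + (½ - ½^1+ n) ≡ ½
    sum = solve 1 (λ p → p :+ (con ½ :- p) := con ½) refl (½^1+ n)

  x⊕y≈½⇒≡ : ∀ m n → x m ⊕ y n ≈ ½𝕀 → ½^1+ m ≡ ½^1+ n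
  x⊕y≈½⇒≡ m n eq =
    p+[½-q]≡½⇒p≡q (½^1+ m) (½^1+ n) (1⊓p≡½⇒p≡½ (fromℚ-injective eq))

theorem1 : ∀ {ℓ : Level} (Ł : ŁukasiewiczLogic) →
    let open ŁukasiewiczLogic Ł in
    (A₁ A₂ : Fin #atoms) → A₁ ≢ A₂ →
    ¬ (Σ[ φ ∈ BooleanCombination {L = logic} {ℓ = ℓ} (About (atomic A₁) (atomic A₂)) ]
    Equivalent φ ⟨ binary ∨ (atomic A₁) (atomic A₂) , singleton ½𝕀 ⟩)
theorem1 Ł A₁ A₂ A₁≢A₂ (φ , φ⇔∨) =
  -- The goal is `⊥`, so the doubly negated colouring can be opened. One point more than there are
  -- colours forces a collision.
  colouring M ⟦A₁⟧ ⟦A₂⟧ (λ (i : Fin (suc (colours M ⟦A₁⟧ ⟦A₂⟧ φ))) → x (toℕ i)) φ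
    λ (c , indiscernible) →
      let i , j , i<j , cᵢ≡cⱼ = pigeonhole (ℕ.n<1+n _) c
          M⊨φ  = Equivalence.from (φ⇔∨ _) (⊕⇒⊨ (x (toℕ i)) (y (toℕ i)) (x⊕y≈½ (toℕ i)))
          -- Only the first coordinate moves, to `x (toℕ j)`; the second remains `y (toℕ i)`.
          M′⊨φ = Equivalence.to (indiscernible i j cᵢ≡cⱼ (y (toℕ i))) M⊨φ
          xⱼ≡xᵢ = x⊕y≈½⇒≡ (toℕ j) (toℕ i) (⊨⇒⊕ _ _ (Equivalence.to (φ⇔∨ _) M′⊨φ))
      in ℚ.<-irrefl xⱼ≡xᵢ (½^1+-antitone i<j)
  where
  open ŁukasiewiczLogic Ł

  -- The default `b` goes to every atom other than `A₁`, hence to `A₂` by distinctness.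
  M : 𝕀 → 𝕀 → Model logic
  M a b = updateAt (λ _ → b) A₁ (λ _ → a)

  ⟦A₁⟧ : ∀ a b → M a b A₁ ≡ a
  ⟦A₁⟧ a b = updateAt-updates A₁ (λ _ → b)

  ⟦A₂⟧ : ∀ a b → M a b A₂ ≡ b
  ⟦A₂⟧ a b = updateAt-minimal A₂ A₁ (λ _ → b) λ A₂≡A₁ → A₁≢A₂ (sym A₂≡A₁)

  f-∨-M : ∀ a b → f₂ ∨ (M a b A₁) (M a b A₂) ≈ a ⊕ b
  f-∨-M a b = subst₂ (λ u v → f₂ ∨ (M a b A₁) (M a b A₂) ≈ u ⊕ v) (⟦A₁⟧ a b) (⟦A₂⟧ a b)
    (f-∨ (M a b A₁) (M a b A₂))

  ∨-sentence : Sentence logic _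
  ∨-sentence = ⟨ binary ∨ (atomic A₁) (atomic A₂) , singleton ½𝕀 ⟩

  ⊕⇒⊨ : ∀ a b → a ⊕ b ≈ ½𝕀 → M a b ⊨ ∨-sentence
  ⊕⇒⊨ a b = ≃ℝ-trans {value (f₂ ∨ (M a b A₁) (M a b A₂))} {value (a ⊕ b)} {value ½𝕀} (f-∨-M a b)

  ⊨⇒⊕ : ∀ a b → M a b ⊨ ∨-sentence → a ⊕ b ≈ ½𝕀
  ⊨⇒⊕ a b = ≃ℝ-trans {value (a ⊕ b)} {value (f₂ ∨ (M a b A₁) (M a b A₂))} {value ½𝕀}
    (≃ℝ-sym {value (f₂ ∨ (M a b A₁) (M a b A₂))} {value (a ⊕ b)} (f-∨-M a b))
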